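{- Let $k,n$ be positive integers with $n\ge \frac{(k+4)(k-1)}{2}+1$. Then there exists a ucycle of the set of all onto functions $f:[n]\to[k]$ for which the preimage cardinality function is non-decreasing, i.e. $|f^{ -1}(\{1\})|\le|f^{ -1}(\{2\})|\le\cdots\le|f^{ -1}(\{k\})|$.
   Context: $[m]=\{1,2,\dots,m\}$. A function $f:[n]\to[k]$ is identified with the string $f(1)f(2)\cdots f(n)$ of length $n$ over the alphabet $[k]$. A ucycle (universal cycle) of a finite nonempty set $\mathcal F$ of strings of length $n$ over $[k]$ is a cyclic sequence $a_1a_2\cdots a_N$ of elements of $[k]$, with $N=|\mathcal F|$ and indices taken modulo $N$, such that the $N$ windows $a_ia_{i+1}\cdots a_{i+n-1}$ ($1\le i\le N$) are exactly the elements of $\mathcal F$, each occurring exactly once. -}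

module Defs where

open import Data.Fin.Base as Fin using (Fin; toℕ)
open import Data.Fin.Properties using (_≟_)
open import Data.Fin.Subset using (Subset; ∣_∣)
open import Data.List.Base as List using (List)
open import Data.List.Membership.Propositional using (_∈_)
open import Data.List.Relation.Unary.Unique.Propositional using (Unique)
open import Data.Nat.Base as ℕ using (ℕ; suc; _+_; NonZero)
open import Data.Nat.DivMod using (_mod_)
open import Data.Product.Base using (_×_; Σ-syntax; ∃-syntax)
open import Data.Vec.Base as Vec using (Vec; lookup)
open import Function.Bundles using (_⇔_)
open import Function.Definitions using (Surjective)
open import Relation.Binary.Definitions using (Monotonic₁)
open import Relation.Binary.PropositionalEquality.Core using (_≡_)
open import Relation.Nullary.Decidable.Core using (does)
open import Relation.Unary using (Pred)

-- The alphabet [k] = {1,…,k} is Fin k, so the letter j is represented by j − 1.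

preimage : ∀ {n k} → (Fin n → Fin k) → Fin k → Subset n
preimage f j = Vec.tabulate (λ i → does (f i ≟ j))

preimageCardinality : ∀ {n k} → (Fin n → Fin k) → Fin k → ℕ
preimageCardinality f j = ∣ preimage f j ∣

OntoNonDecreasing : ∀ {n k} → Pred (Fin n → Fin k) _
OntoNonDecreasing f =
  Surjective _≡_ _≡_ f × Monotonic₁ Fin._≤_ ℕ._≤_ (preimageCardinality f)

-- A string of length n is the function sending a position to the letter there.
ontoNonDecreasingStrings : ∀ n k → Pred (Vec (Fin k) n) _
ontoNonDecreasingStrings n k w = OntoNonDecreasing (lookup w)

window : ∀ {N k} .{{_ : NonZero N}} (n : ℕ) → Vec (Fin k) N → Fin N → Vec (Fin k) n
window {N} n a i = Vec.tabulate (λ j → lookup a ((toℕ i + toℕ j) mod N))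

windows : ∀ {N k} .{{_ : NonZero N}} (n : ℕ) → Vec (Fin k) N → List (Vec (Fin k) n)
windows n a = List.tabulate (window n a)

-- The N windows list the elements of F without repetition, so N = |F|.
IsUcycle : ∀ {ℓ n k N} .{{_ : NonZero N}} → Pred (Vec (Fin k) n) ℓ → Vec (Fin k) N → Set ℓ
IsUcycle {n = n} F a = Unique (windows n a) × (∀ w → w ∈ windows n a ⇔ F w)

HasUcycle : ∀ {ℓ n k} → Pred (Vec (Fin k) n) ℓ → Set ℓ
HasUcycle {k = k} F = ∃[ m ] Σ[ a ∈ Vec (Fin k) (suc m) ] IsUcycle F a

{-# OPTIONS --safe #-}
-- The set F of admissible words is closed under rotation, so its rotation classes
-- are disjoint closed walks, each step from a word a∷u to some u∷ʳb. Two closed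
-- walks containing words with the same tail can be spliced, and such splicings join
-- all of F into one closed walk once any two words of F are linked by changing
-- single letters.
--
-- To link the words, let K + 1 be the number of letters and move every word to
-- letter counts (1, 2, …, K, rest): first lower the leftmost count exceeding its
-- target, turning that letter into the top one, then raise the rightmost
-- deficient count at the expense of the top letter. The bound on n gives
-- rest ≥ 2K + 1. Hence removing one top letter from such a word leaves counts into
-- which any letter may be inserted, and the freed position serves to transpose
-- any two adjacent letters.
module Submission where

open import Defs
open import Data.Nat.Base using (ℕ; NonZero; _+_; _*_; _∸_; _≥_)
open import Data.Nat.DivMod using (_/_)

open import Data.Bool.Base using (if_then_else_)
open import Data.Fin.Base as Fin using (Fin; zero; suc; toℕ; fromℕ; inject₁)
open import Data.Fin.Properties as Fin
  using (_≟_; toℕ-fromℕ; toℕ-fromℕ<; toℕ-inject₁; toℕ<n; toℕ-injective; inject₁ℕ<)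
open import Data.List.Base as List
  using (List; []; _∷_; _++_; [_]; length; drop; replicate; allFin; applyUpTo; filter; cartesianProductWith)
open import Data.List.Membership.Propositional using (_∈_; _∉_; find; lose)
open import Data.List.Membership.Propositional.Properties
  using (∈-++⁺ˡ; ∈-++⁺ʳ; ∈-++⁻; ∈-∃++; ∈-applyUpTo⁺; ∈-applyUpTo⁻; ∈-cartesianProductWith⁺; ∈-allFin;
         ∈-map⁺; ∈-map⁻)
open import Data.List.Properties
  using (++-assoc; ++-identityʳ; ∷ʳ-injective; ≡-dec; length-++; length-replicate; map-tabulate;
         tabulate-cong; tabulate-lookup)
open import Data.List.Relation.Binary.Permutation.Propositional
  using (_↭_; refl; prep; swap; trans; ↭-sym; ↭-trans)
open import Data.List.Relation.Binary.Permutation.Propositional.Properties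
  using (↭-length; shift; ++⁺ˡ; ∷↭∷ʳ)
import Data.List.Relation.Binary.Permutation.Setoid.Properties as Permutation
open import Data.List.Relation.Unary.Any using (here; there; any?)
open import Data.List.Relation.Unary.Unique.Propositional using (Unique)
import Data.List.Relation.Unary.Unique.Propositional.Properties as Unique
open import Data.Nat.Base using (zero; suc; _≤_; _<_; z≤n; s≤s)
open import Data.Nat.DivMod using (_%_; _mod_; m%n<n; m<n⇒m%n≡m; %-distribˡ-+; n%n≡0; m%n%n≡m%n; m*n/n≡m)
open import Data.Nat.Properties as ℕₚ using (+-0-commutativeMonoid; m≤n⇒m≤1+n)
open import Data.Nat.Tactic.RingSolver using (solve-∀)
open import Data.Product.Base using (∃; ∃₂; ∃-syntax; _×_; _,_; proj₁; proj₂)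
open import Data.Sum.Base using (_⊎_; inj₁; inj₂; [_,_]′)
open import Data.Vec.Base as Vec using (Vec; []; _∷_; toList; lookup)
open import Data.Vec.Membership.Propositional.Properties using (∈-lookup; ∈-toList⁺; ∈-toList⁻)
open import Data.Vec.Properties as Vec using (length-toList)
open import Data.Vec.Relation.Unary.Any using (index)
open import Data.Vec.Relation.Unary.Any.Properties using (lookup-index)
open import Function.Base using (_∘_)
open import Function.Bundles using (_⇔_; mk⇔; Equivalence)
open import Level using (0ℓ)
open import Relation.Binary.Construct.Closure.Equivalence using (EqClosure; symmetric)
open import Relation.Binary.Construct.Closure.ReflexiveTransitive using (ε; _◅_; _◅◅_)
open import Relation.Binary.Construct.Closure.Symmetric using (SymClosure; fwd; bwd)
open import Relation.Binary.PropositionalEquality as ≡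
  using (_≡_; _≢_; refl; sym; cong; cong₂; subst; subst₂; module ≡-Reasoning)
open import Relation.Binary.PropositionalEquality.Properties using (setoid)
open import Relation.Nullary
  using (¬_; Dec; does; yes; no; contradiction; ¬?; _×-dec_; _→-dec_; decidable-stable)
open import Relation.Nullary.Decidable using (dec-true; dec-false; map′)
open import Relation.Unary using (Pred; Decidable)

open import Algebra.Properties.CommutativeMonoid.Sum +-0-commutativeMonoid
  using (sum; sum-cong-≗; sum-replicate-zero; sum-init-last; ∑-distrib-+)

private variable
  A : Set

least : ∀ {P : Pred ℕ 0ℓ} → Decidable P → ∀ m →
        (∀ {i} → i < m → ¬ P i) ⊎ ∃[ i ] i < m × P i × (∀ {j} → j < i → ¬ P j)
least P? zero = inj₁ λ ()
least P? (suc m) with least P? m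
... | inj₂ (i , i<m , Pi , below) = inj₂ (i , m≤n⇒m≤1+n i<m , Pi , below)
... | inj₁ none with P? m
...   | yes Pm = inj₂ (m , ℕₚ.≤-refl , Pm , none)
...   | no ¬Pm = inj₁ λ i<1+m → [ none , (λ { refl → ¬Pm }) ]′ (ℕₚ.m≤n⇒m<n∨m≡n (ℕₚ.≤-pred i<1+m))

-- Rotations and walks

rotate : List A → List A
rotate []      = []
rotate (a ∷ w) = w ++ [ a ]

rotateBy : ℕ → List A → List A
rotateBy zero    w = w
rotateBy (suc i) w = rotateBy i (rotate w)

rotateBy-++ : (u v : List A) → rotateBy (length u) (u ++ v) ≡ v ++ u
rotateBy-++ []      v = sym (++-identityʳ v)
rotateBy-++ (a ∷ u) v = begin
  rotateBy (length u) ((u ++ v) ++ [ a ])  ≡⟨ cong (rotateBy (length u)) (++-assoc u v [ a ]) ⟩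
  rotateBy (length u) (u ++ v ++ [ a ])    ≡⟨ rotateBy-++ u (v ++ [ a ]) ⟩
  (v ++ [ a ]) ++ u                        ≡⟨ ++-assoc v [ a ] u ⟩
  v ++ a ∷ u                               ∎
  where open ≡-Reasoning

rotateBy-length : (w : List A) → rotateBy (length w) w ≡ w
rotateBy-length w = ≡.trans (cong (rotateBy (length w)) (sym (++-identityʳ w))) (rotateBy-++ w [])

rotateBy-+ : ∀ i j (w : List A) → rotateBy (i + j) w ≡ rotateBy j (rotateBy i w)
rotateBy-+ zero    j w = refl
rotateBy-+ (suc i) j w = rotateBy-+ i j (rotate w)

rotate-rotateBy : ∀ i (w : List A) → rotate (rotateBy i w) ≡ rotateBy i (rotate w)
rotate-rotateBy zero    w = refl
rotate-rotateBy (suc i) w = rotate-rotateBy i (rotate w)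

rotate-injective : {v w : List A} → rotate v ≡ rotate w → v ≡ w
rotate-injective {v = []}        {[]}        eq = refl
rotate-injective {v = []}        {b ∷ []}    ()
rotate-injective {v = []}        {b ∷ _ ∷ w} ()
rotate-injective {v = a ∷ []}    {[]}        ()
rotate-injective {v = a ∷ _ ∷ v} {[]}        ()
rotate-injective {v = a ∷ v}     {b ∷ w}     eq with ∷ʳ-injective v w eq
... | refl , refl = refl

rotateBy-injective : ∀ i {v w : List A} → rotateBy i v ≡ rotateBy i w → v ≡ w
rotateBy-injective zero    eq = eq
rotateBy-injective (suc i) eq = rotate-injective (rotateBy-injective i eq)

rotateBy-closed : ∀ (P : Pred (List A) 0ℓ) → (∀ {w} → P w → P (rotate w)) →
                  ∀ i {w} → P w → P (rotateBy i w)
rotateBy-closed P closed zero    Pw = Pw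
rotateBy-closed P closed (suc i) Pw = rotateBy-closed P closed i (closed Pw)

-- The words v and w arise from r by inserting a, respectively b, at the same position.
data Change (a b : A) : (v r w : List A) → Set where
  here  : ∀ {r} → Change a b (a ∷ r) r (b ∷ r)
  there : ∀ {c v r w} → Change a b v r w → Change a b (c ∷ v) (c ∷ r) (c ∷ w)

change-sym : ∀ {a b : A} {v r w} → Change a b v r w → Change b a w r v
change-sym here      = here
change-sym (there c) = there (change-sym c)

change-++ : ∀ {a b : A} {v r w} xs → Change a b v r w → Change a b (xs ++ v) (xs ++ r) (xs ++ w)
change-++ []       c = c
change-++ (x ∷ xs) c = there (change-++ xs c)

change-split : ∀ {a b : A} {v r w} → Change a b v r w →
               ∃₂ λ xs ys → v ≡ xs ++ a ∷ ys × w ≡ xs ++ b ∷ ys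
change-split here      = [] , _ , refl , refl
change-split (there c) with change-split c
... | xs , ys , refl , refl = _ ∷ xs , ys , refl , refl

data Step (F : Pred (List A) 0ℓ) (v w : List A) : Set where
  step : ∀ {a b r} → F v → F w → Change a b v r w → Step F v w

-- The words are the vertices here, not the edges, of the de Bruijn graph.
data Edge {A : Set} : List A → List A → Set where
  edge : ∀ {a} u {b} → Edge (a ∷ u) (u ++ [ b ])

-- The list holds the vertices entered, without the starting one. Concatenating walks is therefore
-- plain `_++_`, and a nonempty closed walk has its base as last entry.
data Walk {A : Set} : List A → List (List A) → List A → Set where
  []  : ∀ {u} → Walk u [] u
  _∷_ : ∀ {u v w vs} → Edge u v → Walk v vs w → Walk u (v ∷ vs) w

walk-++ : ∀ {u v w : List A} {us vs} → Walk u us v → Walk v vs w → Walk u (us ++ vs) w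
walk-++ []      q = q
walk-++ (e ∷ p) q = e ∷ walk-++ p q

walk-split : ∀ {u v w : List A} {vs} → Walk u vs v → w ∈ vs →
             ∃₂ λ xs ys → vs ≡ xs ++ ys × Walk u xs w × Walk w ys v
walk-split (e ∷ p) (here refl) = _ , _ , refl , e ∷ [] , p
walk-split (e ∷ p) (there w∈vs) with walk-split p w∈vs
... | xs , ys , refl , q , r = _ ∷ xs , ys , refl , e ∷ q , r

∈-++-swap : ∀ {w : A} xs ys → w ∈ xs ++ ys → w ∈ ys ++ xs
∈-++-swap xs ys = [ ∈-++⁺ʳ ys , ∈-++⁺ˡ ]′ ∘ ∈-++⁻ xs

edge-source : ∀ {a b : A} {u w} → Edge (a ∷ u) w → Edge (b ∷ u) w
edge-source (edge u) = edge u

-- The first edge forgets the first letter of its source, and the source is not in the list, so it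
-- may be exchanged. The membership rules out the empty walk, whose source is tied to its target.
walk-source : ∀ {a b : A} {u v w vs} → v ∈ vs → Walk (a ∷ u) vs w → Walk (b ∷ u) vs w
walk-source _ (e ∷ p) = edge-source e ∷ p

rotate-edge : ∀ (a : A) u → Edge (a ∷ u) (rotate (a ∷ u))
rotate-edge a u = edge u

rotate-walk : ∀ p {w : List A} → 0 < length w →
              Walk w (applyUpTo (λ i → rotateBy (suc i) w) p) (rotateBy p w)
rotate-walk zero    _ = []
rotate-walk (suc p) {a ∷ u} _ =
  rotate-edge a u ∷ rotate-walk p (subst (0 <_) (sym (length-++ u)) (ℕₚ.m≤n+m 1 (length u)))

module _ {A : Set} (_≟ᴬ_ : (a b : A) → Dec (a ≡ b)) where

  -- The rotation class of `w` as a closed walk. `back` yields disjointness: an element shared with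
  -- a rotation-closed list would bring `w` itself into that list.
  record Orbit (w : List A) : Set where
    field
      elements : List (List A)
      unique   : Unique elements
      walk     : Walk w elements w
      self     : w ∈ elements
      closed   : ∀ {x} → x ∈ elements → rotate x ∈ elements
      forth    : ∀ {x} → x ∈ elements → ∃[ i ] x ≡ rotateBy i w
      back     : ∀ {x} → x ∈ elements → ∃[ i ] w ≡ rotateBy i x

  -- The class is listed up to the least positive period `suc q`, which exists because rotating by
  -- the length is the identity. Two equal rotations within this range would, by injectivity of
  -- rotation, give a smaller period.
  orbit : ∀ a (u : List A) → Orbit (a ∷ u)
  orbit a u with least (λ i → ≡-dec _≟ᴬ_ (rotateBy (suc i) w) w) (length w)
    where w = a ∷ u
  ... | inj₁ none = contradiction (rotateBy-length (a ∷ u)) (none ℕₚ.≤-refl)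
  ... | inj₂ (q , _ , period , minimal) = record
    { elements = applyUpTo f p
    ; unique   = Unique.applyUpTo⁺₁ f p distinct
    ; walk     = subst (Walk w _) period (rotate-walk p (s≤s z≤n))
    ; self     = subst (_∈ applyUpTo f p) period (∈-applyUpTo⁺ f ℕₚ.≤-refl)
    ; closed   = closed
    ; forth    = λ x∈ → let (i , _ , eq) = ∈-applyUpTo⁻ f x∈ in suc i , eq
    ; back     = back
    }
    where
    w = a ∷ u
    p = suc q
    f : ℕ → List A
    f i = rotateBy (suc i) w

    distinct : ∀ {i j} → i < j → j < p → f i ≢ f j
    distinct {i} {j} i<j j<p eq with j ∸ i in j∸i≡ | ℕₚ.m+[n∸m]≡n (ℕₚ.<⇒≤ i<j) | ℕₚ.m<n⇒0<n∸m i<j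
    ... | suc d | i+1+d≡j | _ = minimal d<q (sym (rotateBy-injective (suc i) eq′))
      where
      d<q : d < q
      d<q = ℕₚ.≤-trans (subst (_≤ j) j∸i≡ (ℕₚ.m∸n≤m j i)) (ℕₚ.≤-pred j<p)
      eq′ : rotateBy (suc i) w ≡ rotateBy (suc i) (rotateBy (suc d) w)
      eq′ = begin
        rotateBy (suc i) w                    ≡⟨ eq ⟩
        rotateBy (suc j) w                    ≡⟨ cong (λ m → rotateBy (suc m) w) i+1+d≡j ⟨
        rotateBy (suc i + suc d) w            ≡⟨ cong (λ m → rotateBy m w) (ℕₚ.+-comm (suc i) (suc d)) ⟩
        rotateBy (suc d + suc i) w            ≡⟨ rotateBy-+ (suc d) (suc i) w ⟩
        rotateBy (suc i) (rotateBy (suc d) w) ∎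
        where open ≡-Reasoning

    closed : ∀ {x} → x ∈ applyUpTo f p → rotate x ∈ applyUpTo f p
    closed x∈ with ∈-applyUpTo⁻ f x∈
    ... | i , i<p , refl with ℕₚ.m≤n⇒m<n∨m≡n i<p
    ...   | inj₁ 1+i<p = subst (_∈ applyUpTo f p) (sym (rotate-rotateBy (suc i) w)) (∈-applyUpTo⁺ f 1+i<p)
    -- The last entry is `w`, so its rotation wraps around to the first entry.
    ...   | inj₂ refl  = here (cong rotate period)

    back : ∀ {x} → x ∈ applyUpTo f p → ∃[ i ] w ≡ rotateBy i x
    back x∈ with ∈-applyUpTo⁻ f x∈
    ... | i , i<p , refl = p ∸ suc i , sym (begin
      rotateBy (p ∸ suc i) (rotateBy (suc i) w) ≡⟨ rotateBy-+ (suc i) (p ∸ suc i) w ⟨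
      rotateBy (suc i + (p ∸ suc i)) w          ≡⟨ cong (λ m → rotateBy m w) (ℕₚ.m+[n∸m]≡n i<p) ⟩
      rotateBy p w                              ≡⟨ period ⟩
      w                                         ∎)
      where open ≡-Reasoning

-- Counting words of a fixed length

length-filter-≤ : ∀ {P Q : Pred A 0ℓ} (P? : Decidable P) (Q? : Decidable Q) → (∀ {x} → Q x → P x) → ∀ xs →
           length (filter Q? xs) ≤ length (filter P? xs)
length-filter-≤ P? Q? Q⇒P [] = z≤n
length-filter-≤ P? Q? Q⇒P (x ∷ xs) with P? x | Q? x
... | yes _  | yes _  = s≤s (length-filter-≤ P? Q? Q⇒P xs)
... | yes _  | no _   = m≤n⇒m≤1+n (length-filter-≤ P? Q? Q⇒P xs)
... | no ¬Px | yes Qx = contradiction (Q⇒P Qx) ¬Px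
... | no _   | no _   = length-filter-≤ P? Q? Q⇒P xs

-- Used with `P` and `Q` meaning unvisited before and after a splice: the decrease makes the
-- saturation terminate.
length-filter-< : ∀ {P Q : Pred A 0ℓ} (P? : Decidable P) (Q? : Decidable Q) → (∀ {x} → Q x → P x) →
                  ∀ {x xs} → x ∈ xs → P x → ¬ Q x →
                  length (filter Q? xs) < length (filter P? xs)
length-filter-< P? Q? Q⇒P {x} {_ ∷ xs} (here refl) Px ¬Qx with P? x | Q? x
... | yes _  | yes Qx = contradiction Qx ¬Qx
... | yes _  | no _   = s≤s (length-filter-≤ P? Q? Q⇒P xs)
... | no ¬Px | _      = contradiction Px ¬Px
length-filter-< P? Q? Q⇒P {xs = y ∷ xs} (there x∈xs) Px ¬Qx with P? y | Q? y
... | yes _  | yes _  = s≤s (length-filter-< P? Q? Q⇒P x∈xs Px ¬Qx)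
... | yes _  | no _   = m≤n⇒m≤1+n (length-filter-< P? Q? Q⇒P x∈xs Px ¬Qx)
... | no ¬Py | yes Qy = contradiction (Q⇒P Qy) ¬Py
... | no _   | no _   = length-filter-< P? Q? Q⇒P x∈xs Px ¬Qx

words : ∀ k → ℕ → List (List (Fin k))
words k zero    = [ [] ]
words k (suc n) = cartesianProductWith _∷_ (allFin k) (words k n)

∈-words : ∀ {k} (w : List (Fin k)) → w ∈ words k (length w)
∈-words []      = here refl
∈-words (a ∷ w) = ∈-cartesianProductWith⁺ _∷_ (∈-allFin a) (∈-words w)

-- Cycle joining

module CycleJoining {k n : ℕ} {F : Pred (List (Fin k)) 0ℓ} (F? : Decidable F)
  (F-length : ∀ {w} → F w → length w ≡ suc n)
  (F-rotate : ∀ {w} → F w → F (rotate w)) where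

  Word : Set
  Word = List (Fin k)

  infix 4 _∈?_
  _∈?_ : (w : Word) (ws : List Word) → Dec (w ∈ ws)
  w ∈? ws = any? (≡-dec _≟_ w) ws

  -- `root` stays fixed under splicing, whereas `base` may move. By `rotation` the visited set is a
  -- union of rotation classes, so a class with one unvisited word is entirely unvisited.
  record Circuit (root : Word) : Set where
    field
      visited  : List Word
      base     : Word
      walk     : Walk base visited base
      unique   : Unique visited
      within   : ∀ {w} → w ∈ visited → F w
      rotation : ∀ {w} → w ∈ visited → rotate w ∈ visited
      rooted   : root ∈ visited

  open Circuit

  nonempty : ∀ {w} → F w → ∃₂ λ a u → w ≡ a ∷ u
  nonempty {[]}    Fw with () ← F-length Fw
  nonempty {a ∷ u} Fw = a , u , refl

  initial : ∀ {w} → F w → Circuit w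
  initial Fw with nonempty Fw
  ... | a , u , refl = record
    { visited  = O.elements
    ; base     = a ∷ u
    ; walk     = O.walk
    ; unique   = O.unique
    ; within   = λ x∈ → let (i , eq) = O.forth x∈ in subst F (sym eq) (rotateBy-closed F F-rotate i Fw)
    ; rotation = O.closed
    ; rooted   = O.self
    }
    where module O = Orbit (orbit _≟_ a u)

  -- Words with the same tail have the same successors, so two closed walks can be spliced there.
  join : ∀ {r a b u} (c : Circuit r) → a ∷ u ∈ visited c → b ∷ u ∉ visited c → F (b ∷ u) →
         ∃ λ (c′ : Circuit r) → (∀ {w} → w ∈ visited c → w ∈ visited c′) × b ∷ u ∈ visited c′
  join {a = a} {b} {u} record
    { visited = vs ; walk = p ; unique = uniq ; within = inF ; rotation = rot ; rooted = r∈ } au∈ bu∉ Fbu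
    with walk-split p au∈
  ... | xs , ys , refl , p₁ , p₂ = record
    { visited  = O.elements ++ ys ++ xs
    ; base     = a ∷ u
    ; walk     = walk-++ (walk-source O.self O.walk)
                         (walk-source (∈-++-swap xs ys au∈) (walk-++ p₂ p₁))
    ; unique   = Unique.++⁺ O.unique (↭.Unique-resp-↭ (↭.++-comm xs ys) uniq) λ (x∈o , x∈) →
                   let (i , eq) = O.back x∈o
                   in bu∉ (subst (_∈ xs ++ ys) (sym eq) (rotateBy-closed (_∈ xs ++ ys) rot i (∈-++-swap ys xs x∈)))
    ; within   = [ (λ x∈ → let (i , eq) = O.forth x∈ in subst F (sym eq) (rotateBy-closed F F-rotate i Fbu))
                 , inF ∘ ∈-++-swap ys xs ]′ ∘ ∈-++⁻ O.elements
    ; rotation = [ ∈-++⁺ˡ ∘ O.closed , old ∘ rot ∘ ∈-++-swap ys xs ]′ ∘ ∈-++⁻ O.elements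
    ; rooted   = old r∈
    } , old , ∈-++⁺ˡ O.self
    where
    module O = Orbit (orbit _≟_ b u)
    module ↭ = Permutation (setoid Word)
    old : ∀ {w} → w ∈ xs ++ ys → w ∈ O.elements ++ ys ++ xs
    old = ∈-++⁺ʳ O.elements ∘ ∈-++-swap xs ys

  Saturated : ∀ {r} → Circuit r → Set
  Saturated c = ∀ {a b u} → a ∷ u ∈ visited c → F (b ∷ u) → b ∷ u ∈ visited c

  Joinable : ∀ {r} → Circuit r → Word → Set
  Joinable c w = ∃[ b ] F (b ∷ drop 1 w) × b ∷ drop 1 w ∉ visited c

  joinable? : ∀ {r} (c : Circuit r) → Decidable (Joinable c)
  joinable? c w = Fin.any? λ b → F? (b ∷ drop 1 w) ×-dec ¬? (b ∷ drop 1 w ∈? visited c)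

  -- Each splice visits a new word of length `suc n`, so the number of unvisited words falls. It is
  -- kept strictly below `m`, which excludes running out at zero.
  saturate : ∀ {r} m (c : Circuit r) →
             length (filter (¬? ∘ (_∈? visited c)) (words k (suc n))) < m →
             ∃ λ (c′ : Circuit r) → Saturated c′
  saturate (suc m) c bound with any? (joinable? c) (visited c)
  ... | no none = c , λ {a} {b} {u} au∈ Fbu →
          decidable-stable (b ∷ u ∈? visited c) λ bu∉ → none (lose au∈ (b , Fbu , bu∉))
  ... | yes some with find some
  ...   | w , w∈ , b , Fbu , bu∉ with nonempty (within c w∈)
  ...     | a , u , refl with join c w∈ bu∉ Fbu
  ...       | c′ , c⊆c′ , bu∈ = saturate m c′ (ℕₚ.<-≤-trans fewer (ℕₚ.≤-pred bound))
    where
    fewer = length-filter-< (¬? ∘ (_∈? visited c)) (¬? ∘ (_∈? visited c′)) (_∘ c⊆c′)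
              (subst (λ l → b ∷ u ∈ words k l) (F-length Fbu) (∈-words (b ∷ u))) bu∉ (λ bu∉′ → bu∉′ bu∈)

  -- Rotation brings the changed letter to the front. There the two words share a tail, which is the
  -- case that saturation covers; rotating on restores the original position.
  saturated-change : ∀ {r} (c : Circuit r) → Saturated c →
                     ∀ {a b v s w} → v ∈ visited c → F w → Change a b v s w → w ∈ visited c
  saturated-change c sat {a} {b} v∈ Fw ch with change-split ch
  ... | xs , ys , refl , refl =
    subst (_∈ visited c) (rotateBy-++ (b ∷ ys) xs)
      (rotateBy-closed (_∈ visited c) (rotation c) (length (b ∷ ys))
        (sat (subst (_∈ visited c) (rotateBy-++ xs (a ∷ ys))
                    (rotateBy-closed (_∈ visited c) (rotation c) (length xs) v∈))
             (subst F (rotateBy-++ xs (b ∷ ys)) (rotateBy-closed F F-rotate (length xs) Fw))))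

  saturated-connected : ∀ {r} (c : Circuit r) → Saturated c →
                        ∀ {v w} → v ∈ visited c → EqClosure (Step F) v w → w ∈ visited c
  saturated-connected c sat v∈ ε = v∈
  saturated-connected c sat v∈ (fwd (step _ Fw ch) ◅ p) =
    saturated-connected c sat (saturated-change c sat v∈ Fw ch) p
  saturated-connected c sat v∈ (bwd (step Fw _ ch) ◅ p) =
    saturated-connected c sat (saturated-change c sat v∈ Fw (change-sym ch)) p

  full-circuit : ∀ {r} → F r → (∀ {w} → F w → EqClosure (Step F) r w) →
                 ∃ λ (c : Circuit r) → ∀ {w} → F w → w ∈ visited c
  full-circuit Fr connected with saturate _ (initial Fr) (ℕₚ.n<1+n _)
  ... | c , sat = c , λ Fw → saturated-connected c sat (rooted c) (connected Fw)

-- Reading a ucycle off a closed walk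

-- Beyond the end of the list this is the default value.
at : A → List A → ℕ → A
at d []       _       = d
at d (x ∷ xs) zero    = x
at d (x ∷ xs) (suc i) = at d xs i

at-lookup : ∀ d (xs : List A) i → at d xs (toℕ i) ≡ List.lookup xs i
at-lookup d (x ∷ xs) zero    = refl
at-lookup d (x ∷ xs) (suc i) = at-lookup d xs i

at-∈ : ∀ d (xs : List A) {i} → i < length xs → at d xs i ∈ xs
at-∈ d (x ∷ xs) {zero}  _         = here refl
at-∈ d (x ∷ xs) {suc i} (s≤s i<n) = there (at-∈ d xs i<n)

at-++ : ∀ d (xs ys : List A) {i} → i < length xs → at d (xs ++ ys) i ≡ at d xs i
at-++ d (x ∷ xs) ys {zero}  _         = refl
at-++ d (x ∷ xs) ys {suc i} (s≤s i<n) = at-++ d xs ys i<n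

edge-at : ∀ d {v w : List A} → Edge v w → ∀ {j} → suc j < length v → at d v (suc j) ≡ at d w j
edge-at d (edge u) (s≤s j<n) = sym (at-++ d u _ j<n)

walk-at : ∀ d {u v : List A} {vs} → Walk u vs v → ∀ {i} → suc i < length vs →
          Edge (at d vs i) (at d vs (suc i))
walk-at d (_ ∷ e ∷ _)  {zero}  _         = e
walk-at d (_ ∷ p)      {suc i} (s≤s i<n) = walk-at d p i<n

walk-last : ∀ d {u v : List A} {vs} → Walk u vs v → ∀ {i} → suc i ≡ length vs → at d vs i ≡ v
walk-last d (_ ∷ [])    refl = refl
walk-last d (_ ∷ e ∷ p) refl = walk-last d (e ∷ p) refl

suc-% : ∀ t m → suc t % suc m ≡ suc (t % suc m) % suc m
suc-% t m = begin
  suc t % N               ≡⟨ %-distribˡ-+ 1 t N ⟩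
  (1 % N + t % N) % N     ≡⟨ cong (λ x → (1 % N + x) % N) (m%n%n≡m%n t N) ⟨
  (1 % N + t % N % N) % N ≡⟨ %-distribˡ-+ 1 (t % N) N ⟨
  suc (t % N) % N         ∎
  where
  open ≡-Reasoning
  N = suc m

-- Inside the list this is an edge of the walk. At the wrap-around the last entry is the endpoint
-- `u`, and the first edge of the closed walk leads from `u` to the first entry.
cyclic-edge : ∀ d {u v : List A} {vs} → Walk u (v ∷ vs) u → let N = suc (length vs) in
              ∀ t → Edge (at d (v ∷ vs) (t % N)) (at d (v ∷ vs) (suc t % N))
cyclic-edge d {u} {v} {vs} p@(e ∷ _) t
  rewrite suc-% t (length vs) with ℕₚ.m≤n⇒m<n∨m≡n (m%n<n t (suc (length vs)))
... | inj₁ 1+t<N rewrite m<n⇒m%n≡m {{_}} 1+t<N = walk-at d p 1+t<N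
... | inj₂ 1+t≡N rewrite walk-last d p 1+t≡N | 1+t≡N | n%n≡0 (suc (length vs)) {{_}} = e

toList-tabulate-at : ∀ d (w : List A) {n} → length w ≡ n →
                     toList (Vec.tabulate {n = n} (λ j → at d w (toℕ j))) ≡ w
toList-tabulate-at d []      refl = refl
toList-tabulate-at d (a ∷ w) refl = cong (a ∷_) (toList-tabulate-at d w refl)

tabulate-at : ∀ d (xs : List A) → List.tabulate (λ (i : Fin (length xs)) → at d xs (toℕ i)) ≡ xs
tabulate-at d xs = ≡.trans (tabulate-cong (at-lookup d xs)) (tabulate-lookup xs)

toList-∈ : ∀ {n} {w : Vec A n} {ws} → toList w ∈ List.map toList ws → w ∈ ws
toList-∈ {w = w} w∈ with ∈-map⁻ toList w∈
... | v , v∈ , eq = subst (_∈ _) (sym (≡.trans (sym (Vec.cast-is-id refl w)) (Vec.toList-injective refl w v eq))) v∈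

module _ {k n : ℕ} {u v : List (Fin k)} {vs} (p : Walk u (v ∷ vs) u)
  (lengths : ∀ {w} → w ∈ v ∷ vs → length w ≡ n) where

  private
    N : ℕ
    N = suc (length vs)

    at-cycle : ℕ → List (Fin k)
    at-cycle t = at v (v ∷ vs) (t % N)

  at-cycle-length : ∀ t → length (at-cycle t) ≡ n
  at-cycle-length t = lengths (at-∈ v (v ∷ vs) (m%n<n t N))

  -- Every edge shifts the word by one place, so a letter at position `j` reaches the front after
  -- `j` steps.
  at-cycle-letter : ∀ d j → j < n → ∀ t → at d (at-cycle t) j ≡ at d (at-cycle (t + j)) 0
  at-cycle-letter d zero    _     t = cong (λ s → at d (at-cycle s) 0) (sym (ℕₚ.+-identityʳ t))
  at-cycle-letter d (suc j) 1+j<n t = begin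
    at d (at-cycle t) (suc j)        ≡⟨ edge-at d (cyclic-edge v p t) (subst (suc j <_) (sym (at-cycle-length t)) 1+j<n) ⟩
    at d (at-cycle (suc t)) j        ≡⟨ at-cycle-letter d j (ℕₚ.<⇒≤ 1+j<n) (suc t) ⟩
    at d (at-cycle (suc t + j)) 0    ≡⟨ cong (λ s → at d (at-cycle s) 0) (ℕₚ.+-suc t j) ⟨
    at d (at-cycle (t + suc j)) 0    ∎
    where open ≡-Reasoning

  -- The candidate ucycle. The default `d` would be read only from an empty word.
  firstLetters : Fin k → Vec (Fin k) N
  firstLetters d = Vec.tabulate λ i → at d (at v (v ∷ vs) (toℕ i)) 0

  toList-window : ∀ d i → toList (window n (firstLetters d) i) ≡ at v (v ∷ vs) (toℕ i)
  toList-window d i = begin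
    toList (window n (firstLetters d) i)
      ≡⟨ cong toList (Vec.tabulate-cong λ j → begin
        Vec.lookup (firstLetters d) ((toℕ i + toℕ j) mod N)        ≡⟨ Vec.lookup∘tabulate first ((toℕ i + toℕ j) mod N) ⟩
        at d (at v (v ∷ vs) (toℕ ((toℕ i + toℕ j) mod N))) 0
          ≡⟨ cong (λ s → at d (at v (v ∷ vs) s) 0) (toℕ-fromℕ< (m%n<n (toℕ i + toℕ j) N)) ⟩
        at d (at-cycle (toℕ i + toℕ j)) 0                          ≡⟨ at-cycle-letter d (toℕ j) (toℕ<n j) (toℕ i) ⟨
        at d (at-cycle (toℕ i)) (toℕ j)                            ∎) ⟩
    toList (Vec.tabulate {n = n} (λ j → at d (at-cycle (toℕ i)) (toℕ j)))
      ≡⟨ toList-tabulate-at d (at-cycle (toℕ i)) (at-cycle-length (toℕ i)) ⟩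
    at-cycle (toℕ i)
      ≡⟨ cong (at v (v ∷ vs)) (m<n⇒m%n≡m (toℕ<n i)) ⟩
    at v (v ∷ vs) (toℕ i) ∎
    where
    open ≡-Reasoning
    first : Fin N → Fin k
    first i = at d (at v (v ∷ vs) (toℕ i)) 0

  toList-windows : ∀ d → List.map toList (windows n (firstLetters d)) ≡ v ∷ vs
  toList-windows d = begin
    List.map toList (windows n (firstLetters d))                       ≡⟨ map-tabulate (window n (firstLetters d)) toList ⟩
    List.tabulate (toList ∘ window n (firstLetters d))                 ≡⟨ tabulate-cong (toList-window d) ⟩
    List.tabulate (λ (i : Fin N) → at v (v ∷ vs) (toℕ i))              ≡⟨ tabulate-at v (v ∷ vs) ⟩
    v ∷ vs ∎
    where open ≡-Reasoning

-- The windows of the sequence of first letters are the visited words in walk order, so uniqueness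
-- and membership carry over. `r ∈ vs` excludes the empty walk, and the given letter serves as
-- default.
closedWalk⇒hasUcycle : ∀ {k n} {P : Pred (Vec (Fin k) n) 0ℓ} {u vs r} → Fin k → r ∈ vs →
  Walk u vs u → Unique vs → (∀ {w} → w ∈ vs → length w ≡ n) →
  (∀ w → toList w ∈ vs ⇔ P w) → HasUcycle P
closedWalk⇒hasUcycle {n = n} {P} {vs = v ∷ vs} d _ p unique lengths member =
  length vs , a ,
  Unique.map⁻ (subst Unique (sym eq) unique) ,
  λ w → mk⇔ (Equivalence.to (member w) ∘ subst (toList w ∈_) eq ∘ ∈-map⁺ toList)
            (toList-∈ ∘ subst (toList w ∈_) (sym eq) ∘ Equivalence.from (member w))
  where
  a = firstLetters p lengths d
  eq = toList-windows p lengths d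

-- First and last counterexamples in a finite range

smallest : ∀ {n} {P : Pred (Fin n) 0ℓ} → Decidable P →
           (∀ i → P i) ⊎ ∃[ i ] ¬ P i × (∀ j → toℕ j < toℕ i → P j)
smallest {zero}  P? = inj₁ λ ()
smallest {suc n} P? with P? zero
... | no ¬P₀ = inj₂ (zero , ¬P₀ , λ _ ())
... | yes P₀ with smallest (P? ∘ suc)
...   | inj₁ all = inj₁ λ { zero → P₀ ; (suc i) → all i }
...   | inj₂ (i , ¬Pi , below) = inj₂ (suc i , ¬Pi , λ { zero _ → P₀ ; (suc j) (s≤s j<i) → below j j<i })

largest : ∀ {n} {P : Pred (Fin n) 0ℓ} → Decidable P →
          (∀ i → P i) ⊎ ∃[ i ] ¬ P i × (∀ j → toℕ i < toℕ j → P j)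
largest {zero}  P? = inj₁ λ ()
largest {suc n} P? with largest (P? ∘ suc)
... | inj₂ (i , ¬Pi , above) = inj₂ (suc i , ¬Pi , λ { (suc j) (s≤s i<j) → above j i<j })
... | inj₁ all with P? zero
...   | yes P₀ = inj₁ λ { zero → P₀ ; (suc i) → all i }
...   | no ¬P₀ = inj₂ (zero , ¬P₀ , λ { (suc j) _ → all j })

-- Letter counts

-- The Kronecker delta. Branching on `does` lets `δ (suc a) (suc j)` reduce to `δ a j`, which the
-- inductions over the alphabet use silently.
δ : ∀ {k} → Fin k → Fin k → ℕ
δ a j = if does (a ≟ j) then 1 else 0

count : ∀ {k} → Fin k → List (Fin k) → ℕ
count j []      = 0
count j (a ∷ w) = δ a j + count j w

module _ {k : ℕ} where

  δ-≡ : (a : Fin k) → δ a a ≡ 1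
  δ-≡ a rewrite dec-true (a ≟ a) refl = refl

  δ-≢ : {a j : Fin k} → a ≢ j → δ a j ≡ 0
  δ-≢ {a} {j} a≢j rewrite dec-false (a ≟ j) a≢j = refl

  δ≤1 : (a j : Fin k) → δ a j ≤ 1
  δ≤1 a j with a ≟ j
  ... | yes _ = ℕₚ.≤-refl
  ... | no _  = z≤n

  count-++ : ∀ j (v w : List (Fin k)) → count j (v ++ w) ≡ count j v + count j w
  count-++ j []      w = refl
  count-++ j (a ∷ v) w = ≡.trans (cong (δ a j +_) (count-++ j v w)) (sym (ℕₚ.+-assoc (δ a j) _ _))

  count≤length : ∀ j (w : List (Fin k)) → count j w ≤ length w
  count≤length j []      = z≤n
  count≤length j (a ∷ w) = ℕₚ.+-mono-≤ (δ≤1 a j) (count≤length j w)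

  count-positive⇒∈ : ∀ j (w : List (Fin k)) → 1 ≤ count j w → j ∈ w
  count-positive⇒∈ j (a ∷ w) 1≤ with a ≟ j
  ... | yes refl = here refl
  ... | no _     = there (count-positive⇒∈ j w 1≤)

  ∈⇒count-positive : ∀ {j} {w : List (Fin k)} → j ∈ w → 1 ≤ count j w
  ∈⇒count-positive {j} (here refl) rewrite δ-≡ j = s≤s z≤n
  ∈⇒count-positive (there {x = a} j∈) = ℕₚ.m≤n⇒m≤o+n (δ a _) (∈⇒count-positive j∈)

  count-↭ : ∀ {v w : List (Fin k)} → v ↭ w → ∀ j → count j v ≡ count j w
  count-↭ refl           j = refl
  count-↭ (prep a p)     j = cong (δ a j +_) (count-↭ p j)
  count-↭ {w = _ ∷ _ ∷ w} (swap a b p) j =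
    ≡.trans (cong (λ x → δ a j + (δ b j + x)) (count-↭ p j)) (exchange (δ a j) (δ b j) (count j w))
    where
    exchange : ∀ x y z → x + (y + z) ≡ y + (x + z)
    exchange = solve-∀
  count-↭ (trans p q)    j = ≡.trans (count-↭ p j) (count-↭ q j)

  -- Equal counts locate the first letter of `v` somewhere in `w`; removing both occurrences keeps
  -- the counts equal. This reduces linking two words with the same counts to permuting letters.
  count⇒↭ : ∀ (v w : List (Fin k)) → (∀ j → count j v ≡ count j w) → v ↭ w
  count⇒↭ []      []      _  = refl
  count⇒↭ []      (b ∷ w) eq with () ← subst (1 ≤_) (sym (eq b)) (∈⇒count-positive {j = b} {b ∷ w} (here refl))
  count⇒↭ (a ∷ v) w       eq
    with ∈-∃++ (count-positive⇒∈ a w (subst (1 ≤_) (eq a) (∈⇒count-positive {j = a} {a ∷ v} (here refl))))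
  ... | xs , ys , refl = ↭-trans (prep a (count⇒↭ v (xs ++ ys) rest)) (↭-sym (shift a xs ys))
    where
    rest : ∀ j → count j v ≡ count j (xs ++ ys)
    rest j = ℕₚ.+-cancelˡ-≡ (δ a j) _ _ (≡.trans (eq j) (count-↭ (shift a xs ys) j))

  replace : ∀ {a} {v : List (Fin k)} → a ∈ v → ∀ b → ∃₂ λ r w → Change a b v r w
  replace (here refl) b = _ , _ , here
  replace (there a∈)  b with replace a∈ b
  ... | r , w , ch = _ , _ , there ch

  change-↭ : ∀ {a b} {v r w : List (Fin k)} → Change a b v r w → v ↭ a ∷ r
  change-↭ here                = refl
  change-↭ (there {c = c} ch) = trans (prep c (change-↭ ch)) (swap c _ refl)

  sum-δ : (a : Fin k) → sum (δ a) ≡ 1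
  sum-δ = go
    where
    go : ∀ {k} (a : Fin k) → sum (δ a) ≡ 1
    go {suc k} zero    = cong suc (sum-replicate-zero k)
    go         (suc a) = go a

  sum-count : (w : List (Fin k)) → sum (λ j → count j w) ≡ length w
  sum-count []      = sum-replicate-zero k
  sum-count (a ∷ w) = ≡.trans (∑-distrib-+ (δ a) (λ j → count j w)) (cong₂ _+_ (sum-δ a) (sum-count w))

sum-mono-≤ : ∀ {k} {f g : Fin k → ℕ} → (∀ i → f i ≤ g i) → sum f ≤ sum g
sum-mono-≤ {zero}  f≤g = z≤n
sum-mono-≤ {suc k} f≤g = ℕₚ.+-mono-≤ (f≤g zero) (sum-mono-≤ (f≤g ∘ suc))

-- Triangular numbers and the bound on the length

triangle : ℕ → ℕ
triangle k = sum {k} (suc ∘ toℕ)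

triangle-suc : ∀ k → triangle (suc k) ≡ triangle k + suc k
triangle-suc k = begin
  triangle (suc k)                                           ≡⟨ sum-init-last (suc ∘ toℕ) ⟩
  sum {k} (suc ∘ toℕ ∘ inject₁) + suc (toℕ (fromℕ k))        ≡⟨ cong₂ _+_ (sum-cong-≗ (cong suc ∘ toℕ-inject₁ {k}))
                                                                      (cong suc (toℕ-fromℕ k)) ⟩
  triangle k + suc k                                         ∎
  where open ≡-Reasoning

triangle-*2 : ∀ k → triangle k * 2 ≡ k * suc k
triangle-*2 zero    = refl
triangle-*2 (suc k) = begin
  triangle (suc k) * 2        ≡⟨ cong (_* 2) (triangle-suc k) ⟩
  (triangle k + suc k) * 2    ≡⟨ ℕₚ.*-distribʳ-+ 2 (triangle k) (suc k) ⟩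
  triangle k * 2 + suc k * 2  ≡⟨ cong (_+ suc k * 2) (triangle-*2 k) ⟩
  k * suc k + suc k * 2       ≡⟨ identity k ⟩
  suc k * suc (suc k)         ∎
  where
  open ≡-Reasoning
  identity : ∀ k → k * suc k + suc k * 2 ≡ suc k * suc (suc k)
  identity = solve-∀

-- Here `k` is the alphabet size minus one. The right side separates the counts 1, ..., k of the
-- lower letters from the 2k + 1 places left to the top letter. Writing the product as a double
-- makes the division exact.
bound≡ : ∀ k → (suc k + 4) * k / 2 + 1 ≡ triangle k + suc (2 * k)
bound≡ k = begin
  (suc k + 4) * k / 2 + 1        ≡⟨ cong (λ x → x / 2 + 1) doubled ⟩
  (triangle k + 2 * k) * 2 / 2 + 1 ≡⟨ cong (_+ 1) (m*n/n≡m (triangle k + 2 * k) 2) ⟩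
  triangle k + 2 * k + 1         ≡⟨ ℕₚ.+-assoc (triangle k) (2 * k) 1 ⟩
  triangle k + (2 * k + 1)       ≡⟨ cong (triangle k +_) (ℕₚ.+-comm (2 * k) 1) ⟩
  triangle k + suc (2 * k)       ∎
  where
  open ≡-Reasoning
  expand : ∀ k → (suc k + 4) * k ≡ k * suc k + 2 * k * 2
  expand = solve-∀
  doubled : (suc k + 4) * k ≡ (triangle k + 2 * k) * 2
  doubled = ≡.trans (expand k) (≡.trans (cong (_+ 2 * k * 2) (sym (triangle-*2 k)))
                                        (sym (ℕₚ.*-distribʳ-+ 2 (triangle k) (2 * k))))

-- Words with prescribed letter counts

build : ∀ {k} → (Fin k → ℕ) → List (Fin k)
build {zero}  c = []
build {suc k} c = replicate (c zero) zero ++ List.map suc (build (c ∘ suc))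

count-replicate : ∀ {k} m (a j : Fin k) → count j (replicate m a) ≡ m * δ a j
count-replicate zero    a j = refl
count-replicate (suc m) a j = cong (δ a j +_) (count-replicate m a j)

count-map-zero : ∀ {k} (w : List (Fin k)) → count zero (List.map suc w) ≡ 0
count-map-zero []      = refl
count-map-zero (a ∷ w) = count-map-zero w

count-map-suc : ∀ {k} j (w : List (Fin k)) → count (suc j) (List.map suc w) ≡ count j w
count-map-suc j []      = refl
count-map-suc j (a ∷ w) = cong (δ a j +_) (count-map-suc j w)

count-build : ∀ {k} (c : Fin k → ℕ) j → count j (build c) ≡ c j
count-build {suc k} c j = ≡.trans (count-++ j (replicate (c zero) zero) _)
  (≡.trans (cong (_+ count j (List.map suc (build (c ∘ suc)))) (count-replicate (c zero) zero j)) (go j))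
  where
  go : ∀ j → c zero * δ zero j + count j (List.map suc (build (c ∘ suc))) ≡ c j
  go zero    = ≡.trans (cong₂ _+_ (ℕₚ.*-identityʳ (c zero)) (count-map-zero (build (c ∘ suc)))) (ℕₚ.+-identityʳ (c zero))
  go (suc j) = cong₂ _+_ (ℕₚ.*-zeroʳ (c zero)) (≡.trans (count-map-suc j (build (c ∘ suc))) (count-build (c ∘ suc) j))

-- Connecting words by changes of single letters

-- `positive` expresses surjectivity. Since only counts are mentioned, the condition is invariant
-- under all permutations of a word, rotations included.
record Admissible {k} (c : Fin k → ℕ) : Set where
  field
    positive : ∀ i → 1 ≤ c i
    monotone : ∀ {i j} → i Fin.≤ j → c i ≤ c j

open Admissible

admissible-≗ : ∀ {k} {c d : Fin k → ℕ} → (∀ j → c j ≡ d j) → Admissible c → Admissible d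
admissible-≗ eq ad .positive i = subst (1 ≤_) (eq i) (positive ad i)
admissible-≗ eq ad .monotone {i} {j} i≤j rewrite sym (eq i) | sym (eq j) = monotone ad i≤j

OntoMonotone : ∀ {k} → ℕ → List (Fin k) → Set
OntoMonotone n w = length w ≡ n × Admissible (λ j → count j w)

ontoMonotone-↭ : ∀ {k n} {v w : List (Fin k)} → v ↭ w → OntoMonotone n v → OntoMonotone n w
ontoMonotone-↭ p (len , ad) = ≡.trans (sym (↭-length p)) len , admissible-≗ (count-↭ p) ad

≤-split : ∀ {k} {i j : Fin k} → i Fin.≤ j → toℕ i < toℕ j ⊎ i ≡ j
≤-split i≤j with ℕₚ.m≤n⇒m<n∨m≡n i≤j
... | inj₁ i<j = inj₁ i<j
... | inj₂ i≡j = inj₂ (toℕ-injective i≡j)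

module Connectivity (K : ℕ) where

  top : Fin (suc K)
  top = fromℕ K

  below-or-top : ∀ (i : Fin (suc K)) → toℕ i < K ⊎ i ≡ top
  below-or-top i with ℕₚ.m≤n⇒m<n∨m≡n (ℕₚ.≤-pred (toℕ<n i))
  ... | inj₁ i<K = inj₁ i<K
  ... | inj₂ i≡K = inj₂ (toℕ-injective (≡.trans i≡K (sym (toℕ-fromℕ K))))

  below⇒≢top : ∀ {i} → toℕ i < K → top ≢ i
  below⇒≢top i<K refl = ℕₚ.<-irrefl (toℕ-fromℕ K) i<K

  <⇒below : ∀ {i j : Fin (suc K)} → toℕ i < toℕ j → toℕ i < K
  <⇒below {j = j} i<j = ℕₚ.<-≤-trans i<j (ℕₚ.≤-pred (toℕ<n j))

  -- `r` counts the letters left after removing one `i`. Monotonicity is at risk only between `i`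
  -- and a smaller `j`, and there r j ≤ j + 1 ≤ i < r i. A larger top count does no harm.
  admissible-lower : ∀ {i} {r : Fin (suc K) → ℕ} → Admissible (λ j → δ i j + r j) → toℕ i < K → suc (toℕ i) ≤ r i →
                     (∀ j → toℕ j < toℕ i → r j ≤ suc (toℕ j)) → Admissible (λ j → δ top j + r j)
  admissible-lower {i} {r} ad i<K i<r below = record
    { positive = λ j → ℕₚ.m≤n⇒m≤o+n (δ top j) (pos j)
    ; monotone = λ {j} {l} j≤l → mono j l (≤-split j≤l)
    }
    where
    open ℕₚ.≤-Reasoning
    old : ∀ {j} → i ≢ j → δ i j + r j ≡ r j
    old {j} i≢j = cong (_+ r j) (δ-≢ i≢j)
    pos : ∀ j → 1 ≤ r j
    pos j with i ≟ j
    ... | yes refl = ℕₚ.≤-trans (s≤s z≤n) i<r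
    ... | no i≢j   = subst (1 ≤_) (old i≢j) (positive ad j)
    mono : ∀ j l → toℕ j < toℕ l ⊎ j ≡ l → δ top j + r j ≤ δ top l + r l
    mono j l (inj₂ refl) = ℕₚ.≤-refl
    mono j l (inj₁ j<l) rewrite δ-≢ (below⇒≢top (<⇒below j<l)) = ℕₚ.m≤n⇒m≤o+n (δ top l) (less (i ≟ l))
      where
      less : Dec (i ≡ l) → r j ≤ r l
      less (yes refl) = begin
        r j          ≤⟨ below j j<l ⟩
        suc (toℕ j)  ≤⟨ j<l ⟩
        toℕ i        ≤⟨ ℕₚ.<⇒≤ i<r ⟩
        r i          ∎
      less (no i≢l) = begin
        r j          ≤⟨ ℕₚ.m≤n+m (r j) (δ i j) ⟩
        δ i j + r j  ≤⟨ monotone ad (ℕₚ.<⇒≤ j<l) ⟩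
        δ i l + r l  ≡⟨ old i≢l ⟩
        r l          ∎

  -- `r` counts the letters left after removing one top letter. Raising `i` gives at most i + 1,
  -- which is at most `l`, hence at most `r l`, for every `l` above `i`. The lowered top count still
  -- dominates, since r j ≤ j + 1 ≤ K ≤ r top for lower letters `j`.
  admissible-raise : ∀ {i} {r : Fin (suc K) → ℕ} → Admissible (λ j → δ top j + r j) → toℕ i < K → r i ≤ toℕ i →
                     (∀ j → toℕ j < K → r j ≤ suc (toℕ j)) →
                     (∀ j → toℕ i < toℕ j → toℕ j ≤ r j) → K ≤ r top →
                     Admissible (λ j → δ i j + r j)
  admissible-raise {i} {r} ad i<K r≤i bound above K≤r = record
    { positive = λ j → ℕₚ.m≤n⇒m≤o+n (δ i j) (pos j (below-or-top j))
    ; monotone = λ {j} {l} j≤l → mono j l (≤-split j≤l)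
    }
    where
    open ℕₚ.≤-Reasoning
    old : ∀ {j} → toℕ j < K → δ top j + r j ≡ r j
    old {j} j<K = cong (_+ r j) (δ-≢ (below⇒≢top j<K))
    pos : ∀ j → toℕ j < K ⊎ j ≡ top → 1 ≤ r j
    pos j (inj₁ j<K)  = subst (1 ≤_) (old j<K) (positive ad j)
    pos j (inj₂ refl) = ℕₚ.≤-trans (ℕₚ.≤-trans (s≤s z≤n) i<K) K≤r
    mono : ∀ j l → toℕ j < toℕ l ⊎ j ≡ l → δ i j + r j ≤ δ i l + r l
    mono j l (inj₂ refl) = ℕₚ.≤-refl
    mono j l (inj₁ j<l) with i ≟ j
    ... | yes refl = ℕₚ.m≤n⇒m≤o+n (δ i l) (ℕₚ.≤-trans (s≤s r≤i) (ℕₚ.≤-trans j<l (above l j<l)))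
    ... | no _     = ℕₚ.m≤n⇒m≤o+n (δ i l) (less (below-or-top l))
      where
      less : toℕ l < K ⊎ l ≡ top → r j ≤ r l
      less (inj₁ l<K) = begin
        r j           ≤⟨ ℕₚ.m≤n+m (r j) (δ top j) ⟩
        δ top j + r j ≤⟨ monotone ad (ℕₚ.<⇒≤ j<l) ⟩
        δ top l + r l ≡⟨ old l<K ⟩
        r l           ∎
      less (inj₂ refl) = begin
        r j           ≤⟨ bound j (<⇒below j<l) ⟩
        suc (toℕ j)   ≤⟨ <⇒below j<l ⟩
        K             ≤⟨ K≤r ⟩
        r top         ∎

  -- The counts (1, 2, ..., K, rest). The top count is left open: the length of the word fixes it.
  Staircase : (Fin (suc K) → ℕ) → Set
  Staircase c = ∀ j → toℕ j < K → c j ≡ suc (toℕ j)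

  staircase-≥ : ∀ {c} → Staircase c → suc K ≤ c top → ∀ j → suc (toℕ j) ≤ c j
  staircase-≥ {c} stairs K<c j with below-or-top j
  ... | inj₁ j<K  = ℕₚ.≤-reflexive (sym (stairs j j<K))
  ... | inj₂ refl = subst (λ x → suc x ≤ c top) (sym (toℕ-fromℕ K)) K<c

  staircase⇒admissible : ∀ {c} → Staircase c → suc K ≤ c top → Admissible c
  staircase⇒admissible {c} stairs K<c = record
    { positive = λ j → ℕₚ.≤-trans (s≤s z≤n) (atLeast j)
    ; monotone = λ {j} {l} j≤l → mono j l (≤-split j≤l)
    }
    where
    atLeast = staircase-≥ stairs K<c
    mono : ∀ j l → toℕ j < toℕ l ⊎ j ≡ l → c j ≤ c l
    mono j l (inj₂ refl) = ℕₚ.≤-refl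
    mono j l (inj₁ j<l)  = subst (_≤ c l) (sym (stairs j (<⇒below j<l)))
                             (ℕₚ.≤-trans j<l (ℕₚ.<⇒≤ (atLeast l)))

  -- Successive counts of a staircase differ by at least one, so a single insertion can at most make
  -- two of them equal.
  staircase-insert : ∀ {r : Fin (suc K) → ℕ} → Staircase r → suc K ≤ r top → ∀ i → Admissible (λ j → δ i j + r j)
  staircase-insert {r} stairs K<r i = record
    { positive = λ j → ℕₚ.m≤n⇒m≤o+n (δ i j) (ℕₚ.≤-trans (s≤s z≤n) (atLeast j))
    ; monotone = λ {j} {l} j≤l → mono j l (≤-split j≤l)
    }
    where
    open ℕₚ.≤-Reasoning
    atLeast = staircase-≥ stairs K<r
    mono : ∀ j l → toℕ j < toℕ l ⊎ j ≡ l → δ i j + r j ≤ δ i l + r l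
    mono j l (inj₂ refl) = ℕₚ.≤-refl
    mono j l (inj₁ j<l) = begin
      δ i j + r j        ≤⟨ ℕₚ.+-monoˡ-≤ (r j) (δ≤1 i j) ⟩
      suc (r j)          ≡⟨ cong suc (stairs j (<⇒below j<l)) ⟩
      suc (suc (toℕ j))  ≤⟨ s≤s j<l ⟩
      suc (toℕ l)        ≤⟨ atLeast l ⟩
      r l                ≤⟨ ℕₚ.m≤n+m (r l) (δ i l) ⟩
      δ i l + r l        ∎

  -- Reduction to staircase words

  module StaircaseWords (n : ℕ) (large : triangle K + suc (2 * K) ≤ n) where

    Word : Set
    Word = List (Fin (suc K))

    infix 4 _≈_
    _≈_ : Word → Word → Set
    _≈_ = EqClosure (Step (OntoMonotone n))

    Bounded : Word → Set
    Bounded w = ∀ j → toℕ j < K → count j w ≤ suc (toℕ j)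

    -- The lower letters fill at most 1 + ⋯ + K places, and `large` leaves the others to the top
    -- letter.
    bounded⇒top-large : ∀ w → length w ≡ n → Bounded w → suc (2 * K) ≤ count top w
    bounded⇒top-large w len bounded = ℕₚ.+-cancelˡ-≤ (triangle K) _ _ (begin
      triangle K + suc (2 * K)                             ≤⟨ large ⟩
      n                                                    ≡⟨ len ⟨
      length w                                             ≡⟨ sum-count w ⟨
      sum (λ j → count j w)                                ≡⟨ sum-init-last (λ j → count j w) ⟩
      sum {K} (λ j → count (inject₁ j) w) + count top w    ≤⟨ ℕₚ.+-monoˡ-≤ (count top w) (sum-mono-≤ initial) ⟩
      triangle K + count top w                             ∎)
      where
      open ℕₚ.≤-Reasoning
      initial : ∀ j → count (inject₁ j) w ≤ suc (toℕ j)
      initial j = subst (λ x → count (inject₁ j) w ≤ suc x) (toℕ-inject₁ j) (bounded (inject₁ j) (inject₁ℕ< j))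

    change-admissible : ∀ {a b : Fin (suc K)} {v r w} → Change a b v r w → length v ≡ n →
                        Admissible (λ j → δ b j + count j r) →
                        OntoMonotone n w
    change-admissible ch len ad =
      ≡.trans (↭-length (change-↭ (change-sym ch))) (≡.trans (sym (↭-length (change-↭ ch))) len) ,
      admissible-≗ (λ j → sym (count-↭ (change-↭ (change-sym ch)) j)) ad

    implication-fails : ∀ {P Q : Set} → Dec P → ¬ (P → Q) → P × ¬ Q
    implication-fails P? ¬P→Q =
      decidable-stable P? (λ ¬P → ¬P→Q λ p → contradiction p ¬P) , λ q → ¬P→Q λ _ → q

    -- The smallest letter with an excessive count is turned into the top one; being smallest, it
    -- satisfies the hypothesis of `admissible-lower` on the letters below. The top count grows at
    -- each step but cannot exceed `n`, so `d` bounds the number of steps left.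
    connected-bounded : ∀ d w → OntoMonotone n w → n ≤ count top w + d →
                        ∃[ v ] w ≈ v × OntoMonotone n v × Bounded v
    connected-bounded d w Vw@(len , ad) n≤
      with smallest (λ j → (toℕ j ℕₚ.<? K) →-dec (count j w ℕₚ.≤? suc (toℕ j)))
    ... | inj₁ bounded = w , ε , Vw , bounded
    ... | inj₂ (i , unbounded , below) with implication-fails (toℕ i ℕₚ.<? K) unbounded
    ...   | i<K , big′ with ℕₚ.≰⇒> big′
    ...   | big with replace (count-positive⇒∈ i w (ℕₚ.≤-trans (s≤s z≤n) big)) top
    ...     | r , v , ch = continue d n≤
      where
      old : ∀ j → count j w ≡ δ i j + count j r
      old = count-↭ (change-↭ ch)
      Vv : OntoMonotone n v
      Vv = change-admissible ch len (admissible-lower (admissible-≗ old ad) i<K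
        (ℕₚ.≤-pred (subst (suc (suc (toℕ i)) ≤_) (≡.trans (old i) (cong (_+ count i r) (δ-≡ i))) big))
        λ j j<i → ℕₚ.≤-trans (ℕₚ.m≤n+m (count j r) (δ i j))
                    (subst (_≤ suc (toℕ j)) (old j) (below j j<i (<⇒below j<i))))
      more : count top v ≡ suc (count top w)
      more = ≡.trans (count-↭ (change-↭ (change-sym ch)) top)
        (cong₂ _+_ (δ-≡ top) (sym (≡.trans (old top) (cong (_+ count top r) (δ-≢ (below⇒≢top i<K ∘ sym))))))
      continue : ∀ d → n ≤ count top w + d → ∃[ v ] w ≈ v × OntoMonotone n v × Bounded v
      continue zero n≤ = contradiction
        (ℕₚ.≤-trans (subst₂ _≤_ more (proj₁ Vv) (count≤length top v)) (subst (n ≤_) (ℕₚ.+-identityʳ _) n≤))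
        (ℕₚ.<-irrefl refl)
      continue (suc d) n≤
        with connected-bounded d v Vv (subst (n ≤_) (≡.trans (ℕₚ.+-suc _ d) (cong (_+ d) (sym more))) n≤)
      ... | u , v≈u , rest = u , fwd (step Vw Vv ch) ◅ v≈u , rest

    -- A top letter is turned into the largest deficient letter, so that all letters above have
    -- reached their targets, as `admissible-raise` demands. The raised count stays within its
    -- target, which keeps the word bounded. The top count, at most `m`, falls at each step.
    connected-staircase : ∀ m w → OntoMonotone n w → Bounded w → count top w ≤ m →
                          ∃[ v ] w ≈ v × length v ≡ n × Staircase (λ j → count j v)
    connected-staircase m w Vw@(len , ad) bounded ≤m
      with largest (λ j → (toℕ j ℕₚ.<? K) →-dec (suc (toℕ j) ℕₚ.≤? count j w))
    ... | inj₁ full = w , ε , len , λ j j<K → ℕₚ.≤-antisym (bounded j j<K) (full j j<K)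
    ... | inj₂ (i , deficient , above) with implication-fails (toℕ i ℕₚ.<? K) deficient
    ...   | i<K , small with replace (count-positive⇒∈ top w (positive ad top)) i
    ...     | r , v , ch = continue m ≤m
      where
      old : ∀ j → count j w ≡ δ top j + count j r
      old = count-↭ (change-↭ ch)
      new : ∀ j → count j v ≡ δ i j + count j r
      new = count-↭ (change-↭ (change-sym ch))
      old-below : ∀ {j} → toℕ j < K → count j w ≡ count j r
      old-below {j} j<K = ≡.trans (old j) (cong (_+ count j r) (δ-≢ (below⇒≢top j<K)))
      old-top : count top w ≡ suc (count top r)
      old-top = ≡.trans (old top) (cong (_+ count top r) (δ-≡ top))
      r≤i : count i r ≤ toℕ i
      r≤i = ℕₚ.≤-pred (subst (_< suc (toℕ i)) (old-below i<K) (ℕₚ.≰⇒> small))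
      K≤r : K ≤ count top r
      K≤r = ℕₚ.≤-trans (ℕₚ.m≤m+n K (K + 0)) (ℕₚ.≤-pred (subst (suc (2 * K) ≤_) old-top (bounded⇒top-large w len bounded)))
      above′ : ∀ j → toℕ i < toℕ j → toℕ j < K ⊎ j ≡ top → toℕ j ≤ count j r
      above′ j i<j (inj₁ j<K)  = subst (toℕ j ≤_) (old-below j<K) (ℕₚ.<⇒≤ (above j i<j j<K))
      above′ j i<j (inj₂ refl) = subst (_≤ count top r) (sym (toℕ-fromℕ K)) K≤r
      Vv : OntoMonotone n v
      Vv = change-admissible ch len (admissible-raise (admissible-≗ old ad) i<K r≤i
        (λ j j<K → subst (_≤ suc (toℕ j)) (old-below j<K) (bounded j j<K))
        (λ j i<j → above′ j i<j (below-or-top j)) K≤r)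
      bounded′ : Bounded v
      bounded′ j j<K = subst (_≤ suc (toℕ j)) (sym (new j)) (go (i ≟ j))
        where
        go : Dec (i ≡ j) → δ i j + count j r ≤ suc (toℕ j)
        go (yes refl) = ℕₚ.+-mono-≤ (δ≤1 i i) r≤i
        go (no i≢j)   = subst (_≤ suc (toℕ j)) (≡.trans (old-below j<K) (cong (_+ count j r) (sym (δ-≢ i≢j)))) (bounded j j<K)
      continue : ∀ m → count top w ≤ m → ∃[ v ] w ≈ v × length v ≡ n × Staircase (λ j → count j v)
      continue zero    ≤0 = contradiction (subst (_≤ 0) old-top ≤0) λ ()
      continue (suc m) ≤m with connected-staircase m v Vv bounded′
        (subst (_≤ m) (sym (≡.trans (new top) (cong (_+ count top r) (δ-≢ (below⇒≢top i<K ∘ sym)))))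
          (ℕₚ.≤-pred (subst (_≤ suc m) old-top ≤m)))
      ... | u , v≈u , rest = u , fwd (step Vw Vv ch) ◅ v≈u , rest

    -- Transposing adjacent letters of a staircase word

    record Core (r : Word) : Set where
      constructor core
      field
        core-length : suc (length r) ≡ n
        core-stairs : Staircase (λ j → count j r)
        core-top    : suc K ≤ count top r

    core-↭ : ∀ {r s} → r ↭ s → Core r → Core s
    core-↭ p (core len stairs large) = core
      (≡.trans (cong suc (sym (↭-length p))) len)
      (λ j j<K → ≡.trans (sym (count-↭ p j)) (stairs j j<K))
      (subst (suc K ≤_) (count-↭ p top) large)

    -- Into a core word any letter may be inserted, so the inserted letter can be changed freely.
    core-step : ∀ {a b v r w} → Core r → Change a b v r w → SymClosure (Step (OntoMonotone n)) v w
    core-step {a} {b} (core len stairs large) ch = fwd (step (V (change-sym ch)) (V ch) ch)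
      where
      V : ∀ {a b v w} → Change a b v _ w → OntoMonotone n w
      V {b = b} ch = ≡.trans (↭-length (change-↭ (change-sym ch))) len ,
        admissible-≗ (λ j → sym (count-↭ (change-↭ (change-sym ch)) j)) (staircase-insert stairs large b)

    IsStaircase : Word → Set
    IsStaircase w = length w ≡ n × Staircase (λ j → count j w)

    isStaircase-↭ : ∀ {v w} → v ↭ w → IsStaircase v → IsStaircase w
    isStaircase-↭ p (len , stairs) = ≡.trans (sym (↭-length p)) len ,
      λ j j<K → ≡.trans (sym (count-↭ p j)) (stairs j j<K)

    isStaircase⇒top-large : ∀ w → IsStaircase w → suc (2 * K) ≤ count top w
    isStaircase⇒top-large w (len , stairs) = bounded⇒top-large w len (λ j j<K → ℕₚ.≤-reflexive (stairs j j<K))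

    -- Of at least 2K + 1 top letters at least 2K remain, and this is at least K + 1 once K is
    -- positive.
    isStaircase⇒core : ∀ {w r} → 0 < K → IsStaircase w → w ↭ top ∷ r → Core r
    isStaircase⇒core {w} {r} 0<K st@(len , stairs) p = core
      (≡.trans (sym (↭-length p)) len)
      (λ j j<K → ≡.trans (sym (≡.trans (count-↭ p j) (cong (_+ count j r) (δ-≢ (below⇒≢top j<K))))) (stairs j j<K))
      (ℕₚ.≤-trans (ℕₚ.m<m+n K (subst (0 <_) (sym (ℕₚ.+-identityʳ K)) 0<K))
        (ℕₚ.≤-pred (subst (suc (2 * K) ≤_) (≡.trans (count-↭ p top) (cong (_+ count top r) (δ-≡ top)))
          (isStaircase⇒top-large w st))))

    -- The intermediate word has `j` in both places; the second `j` then becomes the top letter.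
    swap-top : ∀ {j} xs ys → Core (xs ++ j ∷ ys) → xs ++ top ∷ j ∷ ys ≈ xs ++ j ∷ top ∷ ys
    swap-top xs ys c = core-step c (change-++ xs here) ◅ core-step c (change-++ xs (there here)) ◅ ε

    -- The place of the top letter holds a spare `j`: i j ... top, i j ... j, i i ... j, j i ... j,
    -- j i ... top. The two middle changes insert into the core `c′`, in which `j` has moved to that
    -- place.
    swap-before : ∀ {i j} xs ys zs → Core (xs ++ i ∷ j ∷ ys ++ zs) →
                  xs ++ i ∷ j ∷ ys ++ top ∷ zs ≈ xs ++ j ∷ i ∷ ys ++ top ∷ zs
    swap-before {i} {j} xs ys zs c =
      core-step c (change-++ xs (there (there (change-++ ys here)))) ◅
      core-step c′ (change-++ xs (there here)) ◅
      core-step c′ (change-++ xs here) ◅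
      core-step (core-↭ (++⁺ˡ xs (swap i j refl)) c) (change-++ xs (there (there (change-++ ys here)))) ◅ ε
      where
      c′ : Core (xs ++ i ∷ ys ++ j ∷ zs)
      c′ = core-↭ (++⁺ˡ xs (prep i (↭-sym (shift j ys zs)))) c

    -- The mirror image: top ... i j, j ... i j, j ... i i, j ... j i, top ... j i.
    swap-after : ∀ {i j} xs ys zs → Core (xs ++ ys ++ i ∷ j ∷ zs) →
                 xs ++ top ∷ ys ++ i ∷ j ∷ zs ≈ xs ++ top ∷ ys ++ j ∷ i ∷ zs
    swap-after {i} {j} xs ys zs c =
      core-step c (change-++ xs here) ◅
      core-step c′ (change-++ xs (there (change-++ ys (there here)))) ◅
      core-step c′ (change-++ xs (there (change-++ ys here))) ◅
      core-step (core-↭ (++⁺ˡ xs (++⁺ˡ ys (swap i j refl))) c) (change-++ xs here) ◅ ε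
      where
      c′ : Core (xs ++ j ∷ ys ++ i ∷ zs)
      c′ = core-↭ (++⁺ˡ xs (trans (++⁺ˡ ys (swap i j refl)) (shift j ys (i ∷ zs)))) c

    -- If neither letter is the top one, a top letter occurs before or after the pair and lends its
    -- place. A letter below the top forces K to be positive, as the passage to a core requires.
    swap-adjacent : ∀ i j xs ys → IsStaircase (xs ++ i ∷ j ∷ ys) → xs ++ i ∷ j ∷ ys ≈ xs ++ j ∷ i ∷ ys
    swap-adjacent i j xs ys st with below-or-top i | below-or-top j
    ... | inj₂ refl | inj₂ refl = ε
    ... | inj₂ refl | inj₁ j<K  = swap-top xs ys (isStaircase⇒core (ℕₚ.m<n⇒0<n j<K) st (shift top xs (j ∷ ys)))
    ... | inj₁ i<K  | inj₂ refl = symmetric _ (swap-top xs ys (isStaircase⇒core (ℕₚ.m<n⇒0<n i<K) st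
                                    (trans (++⁺ˡ xs (swap i top refl)) (shift top xs (i ∷ ys)))))
    ... | inj₁ i<K  | inj₁ j<K
      with ∈-++⁻ xs (count-positive⇒∈ top (xs ++ i ∷ j ∷ ys)
             (ℕₚ.≤-trans (s≤s z≤n) (isStaircase⇒top-large (xs ++ i ∷ j ∷ ys) st)))
    ...   | inj₂ (here top≡i)         = contradiction top≡i (below⇒≢top i<K)
    ...   | inj₂ (there (here top≡j)) = contradiction top≡j (below⇒≢top j<K)
    ...   | inj₂ (there (there top∈)) with ∈-∃++ top∈
    ...     | zs , ws , refl = swap-before xs zs ws (isStaircase⇒core (ℕₚ.m<n⇒0<n i<K) st
                (trans (++⁺ˡ xs (shift top (i ∷ j ∷ zs) ws)) (shift top xs (i ∷ j ∷ zs ++ ws))))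
    swap-adjacent i j xs ys st | inj₁ i<K | inj₁ j<K | inj₁ top∈ with ∈-∃++ top∈
    ...     | zs , ws , refl rewrite ++-assoc zs (top ∷ ws) (i ∷ j ∷ ys) | ++-assoc zs (top ∷ ws) (j ∷ i ∷ ys) =
                swap-after zs ws ys (isStaircase⇒core (ℕₚ.m<n⇒0<n i<K) st (shift top zs (ws ++ i ∷ j ∷ ys)))

    -- The permutation recurses into tails while the staircase condition concerns the whole word;
    -- `xs` carries the letters already passed.
    permutation-connected : ∀ {ys zs} → ys ↭ zs → ∀ xs → IsStaircase (xs ++ ys) → xs ++ ys ≈ xs ++ zs
    permutation-connected refl xs st = ε
    permutation-connected (prep {ys} {zs} x p) xs st =
      subst₂ _≈_ (++-assoc xs [ x ] ys) (++-assoc xs [ x ] zs)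
        (permutation-connected p (xs ++ [ x ]) (subst IsStaircase (sym (++-assoc xs [ x ] ys)) st))
    permutation-connected (swap {ys} {zs} x y p) xs st =
      swap-adjacent x y xs ys st ◅◅
      subst₂ _≈_ (++-assoc xs (y ∷ x ∷ []) ys) (++-assoc xs (y ∷ x ∷ []) zs)
        (permutation-connected p (xs ++ y ∷ x ∷ [])
          (subst IsStaircase (sym (++-assoc xs (y ∷ x ∷ []) ys)) (isStaircase-↭ (++⁺ˡ xs (swap x y refl)) st)))
    permutation-connected (trans p q) xs st =
      permutation-connected p xs st ◅◅ permutation-connected q xs (isStaircase-↭ (++⁺ˡ xs p) st)

    -- `w` is linked to a staircase word `y`. The lower counts of `v` and `y` agree, hence by equal
    -- length the top counts do too, and the two words are permutations of each other.
    connected : ∀ v {w} → IsStaircase v → OntoMonotone n w → v ≈ w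
    connected v {w} st@(len , stairs) Vw with connected-bounded n w Vw (ℕₚ.m≤n+m n _)
    ... | x , w≈x , Vx , bounded with connected-staircase _ x Vx bounded ℕₚ.≤-refl
    ...   | y , x≈y , len′ , stairs′ =
      permutation-connected (count⇒↭ v y same) [] st ◅◅ symmetric _ (w≈x ◅◅ x≈y)
      where
      below-same : ∀ j → toℕ j < K → count j v ≡ count j y
      below-same j j<K = ≡.trans (stairs j j<K) (sym (stairs′ j j<K))
      init-sum : Word → ℕ
      init-sum z = sum {K} λ j → count (inject₁ j) z
      total : ∀ z → length z ≡ n → init-sum z + count top z ≡ n
      total z len = ≡.trans (sym (sum-init-last (λ j → count j z))) (≡.trans (sum-count z) len)
      same′ : ∀ j → toℕ j < K ⊎ j ≡ top → count j v ≡ count j y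
      same′ j (inj₁ j<K)  = below-same j j<K
      same′ j (inj₂ refl) = ℕₚ.+-cancelˡ-≡ (init-sum v) _ _
        (≡.trans (total v len) (≡.trans (sym (total y len′))
          (cong (_+ count top y) (sum-cong-≗ {K} λ i → sym (below-same (inject₁ i) (inject₁ℕ< i))))))
      same : ∀ j → count j v ≡ count j y
      same j = same′ j (below-or-top j)

    -- `build` already supplies K + 1 top letters, so the padding is `n` minus `triangle (suc K)`
    -- rather than `triangle K`.
    root : Word
    root = build (suc ∘ toℕ) ++ replicate (n ∸ triangle (suc K)) top

    triangle≤n : triangle (suc K) ≤ n
    triangle≤n = begin
      triangle (suc K)           ≡⟨ triangle-suc K ⟩
      triangle K + suc K         ≤⟨ ℕₚ.+-monoʳ-≤ (triangle K) (s≤s (ℕₚ.m≤m+n K (K + 0))) ⟩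
      triangle K + suc (2 * K)   ≤⟨ large ⟩
      n                          ∎
      where open ℕₚ.≤-Reasoning

    root-isStaircase : IsStaircase root
    root-isStaircase = len , stairs
      where
      m = n ∸ triangle (suc K)
      len : length root ≡ n
      len = begin
        length root                                              ≡⟨ length-++ (build c) ⟩
        length (build c) + length (replicate m top)              ≡⟨ cong₂ _+_ (sym (sum-count (build c))) (length-replicate m) ⟩
        sum (λ j → count j (build c)) + m                        ≡⟨ cong (_+ m) (sum-cong-≗ (count-build c)) ⟩
        triangle (suc K) + m                                     ≡⟨ ℕₚ.m+[n∸m]≡n triangle≤n ⟩
        n                                                        ∎
        where
        open ≡-Reasoning
        c : Fin (suc K) → ℕ
        c = suc ∘ toℕ
      stairs : Staircase (λ j → count j root)
      stairs j j<K = begin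
        count j root                                               ≡⟨ count-++ j (build (suc ∘ toℕ)) _ ⟩
        count j (build (suc ∘ toℕ)) + count j (replicate m top)    ≡⟨ cong₂ _+_ (count-build (suc ∘ toℕ) j) (count-replicate m top j) ⟩
        suc (toℕ j) + m * δ top j                                  ≡⟨ cong (λ x → suc (toℕ j) + m * x) (δ-≢ (below⇒≢top j<K)) ⟩
        suc (toℕ j) + m * 0                                        ≡⟨ cong (suc (toℕ j) +_) (ℕₚ.*-zeroʳ m) ⟩
        suc (toℕ j) + 0                                            ≡⟨ ℕₚ.+-identityʳ _ ⟩
        suc (toℕ j)                                                ∎
        where open ≡-Reasoning

    isStaircase⇒ontoMonotone : ∀ w → IsStaircase w → OntoMonotone n w
    isStaircase⇒ontoMonotone w st@(len , stairs) =
      len , staircase⇒admissible stairs (ℕₚ.≤-trans (s≤s (ℕₚ.m≤m+n K (K + 0))) (isStaircase⇒top-large w st))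

-- Functions as words, and the conclusion

admissible? : ∀ {k} (c : Fin k → ℕ) → Dec (Admissible c)
admissible? c = map′
  (λ (pos , mono) → record { positive = pos ; monotone = λ {i} {j} → mono i j })
  (λ ad → positive ad , λ i j → monotone ad {i} {j})
  (Fin.all? (λ i → 1 ℕₚ.≤? c i) ×-dec
   Fin.all? λ i → Fin.all? λ j → (i Fin.≤? j) →-dec (c i ℕₚ.≤? c j))

ontoMonotone? : ∀ {k} n → Decidable (OntoMonotone {k} n)
ontoMonotone? n w = (length w ℕₚ.≟ n) ×-dec admissible? (λ j → count j w)

rotate-↭ : ∀ (w : List A) → w ↭ rotate w
rotate-↭ []      = refl
rotate-↭ (a ∷ w) = ∷↭∷ʳ a w

preimageCardinality≡count : ∀ {n k} (w : Vec (Fin k) n) j →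
                            preimageCardinality (lookup w) j ≡ count j (toList w)
preimageCardinality≡count []      j = refl
preimageCardinality≡count (a ∷ w) j with a ≟ j
... | yes _ = cong suc (preimageCardinality≡count w j)
... | no _  = preimageCardinality≡count w j

ontoMonotone⇔ontoNonDecreasing : ∀ {n k} (w : Vec (Fin k) n) →
                                 OntoMonotone n (toList w) ⇔ ontoNonDecreasingStrings n k w
ontoMonotone⇔ontoNonDecreasing w = mk⇔
  (λ (_ , ad) →
    (λ j → let j∈ = ∈-toList⁻ (count-positive⇒∈ j (toList w) (positive ad j))
           in index j∈ , λ { refl → sym (lookup-index j∈) }) ,
    λ {i} {j} i≤j → subst₂ _≤_ (sym (preimageCardinality≡count w i)) (sym (preimageCardinality≡count w j))
                      (monotone ad i≤j))
  (λ (onto , mono) → length-toList w , record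
    { positive = λ j → let (i , eq) = onto j
                       in ∈⇒count-positive (subst (_∈ toList w) (eq refl) (∈-toList⁺ (∈-lookup i w)))
    ; monotone = λ {i} {j} i≤j → subst₂ _≤_ (preimageCardinality≡count w i) (preimageCardinality≡count w j)
                                   (mono i≤j)
    })

theorem2 : (k n : ℕ) .{{_ : NonZero k}} .{{_ : NonZero n}} →
    n ≥ ((k + 4) * (k ∸ 1)) / 2 + 1 →
    HasUcycle (ontoNonDecreasingStrings n k)
theorem2 (suc K) (suc m) n≥ =
  -- `zero` is the default letter, and `rooted c` shows that the walk is nonempty.
  closedWalk⇒hasUcycle zero (rooted c) (walk c) (unique c) (proj₁ ∘ within c) λ w →
    mk⇔ (Equivalence.to (ontoMonotone⇔ontoNonDecreasing w) ∘ within c)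
        (complete ∘ Equivalence.from (ontoMonotone⇔ontoNonDecreasing w))
  where
  n = suc m
  large : triangle K + suc (2 * K) ≤ n
  large = subst (_≤ n) (bound≡ K) n≥
  open Connectivity.StaircaseWords K n large
  open CycleJoining (ontoMonotone? n) proj₁ (λ {w} → ontoMonotone-↭ (rotate-↭ w))
  open Circuit
  full = full-circuit (isStaircase⇒ontoMonotone root root-isStaircase) (connected root root-isStaircase)
  c = proj₁ full
  complete = proj₂ full
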